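{- Let $G_0,G_1\in\mathbb{Z}$, let $(G_n)_{n\ge0}$ satisfy $G_n=G_{n-1}+G_{n-2}$ for $n\ge2$, and let $\mu = G_1^2 - G_0 G_1 - G_0^2$. For all $k\ge 1$, $$\mathcal{G}^2_{G_0,G_1}(k) = \begin{cases} \gcd\left(G_{k+1}^2 - G_1^2,\; G_{k+2}^2 - G_2^2\right), & \text{if $k$ is even},\\ \gcd\left(2 \mu,\; G_{k+1}^2 - G_1^2,\; G_{k+2}^2 - G_2^2\right), & \text{if $k$ is odd}.\end{cases}$$
   Context: $\mathcal{G}^2_{G_0,G_1}(k)=\gcd\{\sum_{i=1}^k G_{n+i}^2 : n\ge 0\}$ (nonnegative gcd of this infinite set of integers). -}

module Defs where

open import Data.Fin.Base using (toℕ)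
open import Data.Integer.Base
  using (ℤ; +_; 0ℤ; _+_; _-_; _*_; _^_; _≤_; ∣_∣)
open import Data.Integer.Divisibility using (_∣_)
open import Data.Integer.Properties using (+-0-commutativeMonoid; 0≤i⇒+∣i∣≡i)
open import Algebra.Properties.CommutativeMonoid.Sum +-0-commutativeMonoid
  using (sum-syntax)
open import Data.Nat.Base as ℕ using (ℕ; suc)
import Data.Nat.Divisibility as ℕ
open import Relation.Binary.PropositionalEquality
  using (_≡_; cong; module ≡-Reasoning)

IsFibonacciLike : (ℕ → ℤ) → Set
IsFibonacciLike G = ∀ n → G (2 ℕ.+ n) ≡ G (1 ℕ.+ n) + G n

μ : (ℕ → ℤ) → ℤ
μ G = G 1 ^ 2 - G 0 * G 1 - G 0 ^ 2

-- The sum of f i over 1 ≤ i ≤ k; Fin indices start at 0, hence the shift.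
∑₁ : ℕ → (ℕ → ℤ) → ℤ
∑₁ k f = ∑[ i < k ] f (suc (toℕ i))

-- The gcd of an arbitrary family cannot be computed constructively, so it is
-- given as a relation: g is the nonnegative common divisor of all values of f
-- that is divisible by every common divisor.  In particular a family that is
-- identically zero has gcd 0.
record IsGCD {I : Set} (f : I → ℤ) (g : ℤ) : Set where
  field
    nonneg   : 0ℤ ≤ g
    divides  : ∀ i → g ∣ f i
    greatest : ∀ d → (∀ i → d ∣ f i) → d ∣ g

IsGCD-unique : ∀ {I : Set} {f : I → ℤ} {g h} → IsGCD f g → IsGCD f h → g ≡ h
IsGCD-unique {g = g} {h} G H = begin
  g        ≡⟨ 0≤i⇒+∣i∣≡i G.nonneg ⟨
  + ∣ g ∣  ≡⟨ cong +_ (ℕ.∣-antisym (H.greatest g G.divides)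
                                   (G.greatest h H.divides)) ⟩
  + ∣ h ∣  ≡⟨ 0≤i⇒+∣i∣≡i H.nonneg ⟩
  h        ∎
  where
  open ≡-Reasoning
  module G = IsGCD G
  module H = IsGCD H

-- 𝒢²[ G , k ]≡ g  says that g is the gcd of all sums of k consecutive squares
-- G (n + 1) ^ 2 + ⋯ + G (n + k) ^ 2 with n ≥ 0.
𝒢²[_,_]≡_ : (ℕ → ℤ) → ℕ → ℤ → Set
𝒢²[ G , k ]≡ g = IsGCD (λ n → ∑₁ k (λ i → G (n ℕ.+ i) ^ 2)) g

{-# OPTIONS --safe #-}
-- Put a n = G n ^ 2 and S n = a (n + 1) + ⋯ + a (n + k).  The defect
-- a (n + 2) - 3 a (n + 1) + a n equals -2 (-1)ⁿ μ, so it alternates in sign and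
-- the corresponding defect S (n + 2) - 3 S (n + 1) + S n, being a sum of k of
-- these, vanishes for even k and is ± 2 μ for odd k.  Modulo its defect at 0, S
-- thus satisfies a linear recurrence of order two, and S 0 and S 1 are integer
-- combinations of that defect and the differences S 1 - S 0 and S 2 - S 1, which
-- telescope to a (k + 1) - a 1 and a (k + 2) - a 2.
module Submission where

open import Defs
open import Data.Integer.Base
  using (ℤ; +_; 0ℤ; _+_; _-_; -_; _*_; _^_; ∣_∣; +≤+)
open import Data.Integer.Divisibility.Signed as Signed
  using (∣ᵤ⇒∣; ∣⇒∣ᵤ; ∣m∣n⇒∣m+n; ∣m∣n⇒∣m-n; ∣m⇒∣-m; ∣n⇒∣m*n)
open import Data.Integer.GCD using (gcd; gcd[i,j]∣i; gcd[i,j]∣j; gcd-greatest)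
open import Data.Integer.Properties
  using (+-0-commutativeMonoid; i≡j⇒i-j≡0; +-identityʳ; neg-involutive; neg-distribʳ-*)
open import Algebra.Properties.CommutativeMonoid.Sum +-0-commutativeMonoid
  using (sum-cong-≗)
open import Data.Integer.Solver using (module +-*-Solver)
open import Data.Integer.Tactic.RingSolver using (solve-∀)
open import Data.Fin.Base using (toℕ)
open import Data.Nat.Base as ℕ using (ℕ; zero; suc; z≤n)
open import Data.Nat.Divisibility
  using (_∣_; _∤_; ∣m+n∣m⇒∣n; ∣-refl; _∣0; ∣1⇒≡1)
  renaming (∣m∣n⇒∣m+n to ∣m∣n⇒∣m+n-ℕ)
open import Data.Nat.GCD using (gcd-identityˡ)
import Data.Nat.Properties as ℕ
open import Data.Product.Base using (_×_; _,_; proj₁; proj₂)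
open import Relation.Nullary.Negation using (contradiction)
open import Relation.Binary.PropositionalEquality
  using (_≡_; refl; sym; trans; cong; cong₂; subst; subst₂; module ≡-Reasoning)

open ≡-Reasoning
open +-*-Solver using (solve; con; _:+_; _:-_; _:*_; _:^_; :-_; _:=_)

-- The coefficients are those of `x² - 3x + 1`, whose roots are the squares of the roots of
-- `x² - x - 1`. The product of the latter roots is -1, so the squares of a Fibonacci-like sequence
-- leave only an alternating remainder.
defect : (ℕ → ℤ) → ℕ → ℤ
defect f n = f (2 ℕ.+ n) - + 3 * f (1 ℕ.+ n) + f n

window : ℕ → (ℕ → ℤ) → ℕ → ℤ
window k f n = ∑₁ k (λ i → f (n ℕ.+ i))

window-suc : ∀ k f n → window (suc k) f n ≡ f (suc n) + window k f (suc n)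
window-suc k f n = cong₂ _+_
  (cong f (ℕ.+-comm n 1))
  (sum-cong-≗ {k} λ i → cong f (ℕ.+-suc n (suc (toℕ i))))

-- Neighbouring windows share all but one term at each end. With the index written `k + suc n`, the
-- cases `n = 0` and `n = 1` compute to the differences in the theorem.
window-step : ∀ k f n →
  window k f (suc n) - window k f n ≡ f (k ℕ.+ suc n) - f (suc n)
window-step zero    f n = sym (i≡j⇒i-j≡0 {f (suc n)} refl)
window-step (suc k) f n
  rewrite window-suc k f (suc n) | window-suc k f n = begin
  (y + t) - (x + s)              ≡⟨ rearrange x y s t ⟩
  (t - s) + (y - x)              ≡⟨ cong (_+ (y - x)) (window-step k f (suc n)) ⟩
  (f (k ℕ.+ suc (suc n)) - y) + (y - x)  ≡⟨ cancel (f (k ℕ.+ suc (suc n))) y x ⟩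
  f (k ℕ.+ suc (suc n)) - x      ≡⟨ cong (λ m → f m - x) (ℕ.+-suc k (suc n)) ⟩
  f (suc k ℕ.+ suc n) - x        ∎
  where
  x = f (suc n)
  y = f (2 ℕ.+ n)
  s = window k f (suc n)
  t = window k f (2 ℕ.+ n)
  rearrange : ∀ x y s t → (y + t) - (x + s) ≡ (t - s) + (y - x)
  rearrange = solve-∀
  cancel : ∀ z y x → (z - y) + (y - x) ≡ z - x
  cancel = solve-∀

defect-window-suc : ∀ k f n →
  defect (window (suc k) f) n ≡ defect f (suc n) + defect (window k f) (suc n)
defect-window-suc k f n
  rewrite window-suc k f n | window-suc k f (1 ℕ.+ n) | window-suc k f (2 ℕ.+ n) =
  additive (f (3 ℕ.+ n)) (f (2 ℕ.+ n)) (f (1 ℕ.+ n))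
           (window k f (3 ℕ.+ n)) (window k f (2 ℕ.+ n)) (window k f (1 ℕ.+ n))
  where
  additive : ∀ x y z u v w →
    (x + u) - + 3 * (y + v) + (z + w) ≡ (x - + 3 * y + z) + (u - + 3 * v + w)
  additive = solve-∀

Alternating : (ℕ → ℤ) → Set
Alternating c = ∀ n → c (suc n) ≡ - c n

-- The first two terms of the window contribute opposite defects, which cancel.
defect-window-+2 : ∀ f → Alternating (defect f) → ∀ k n →
  defect (window (2 ℕ.+ k) f) n ≡ defect (window k f) (2 ℕ.+ n)
defect-window-+2 f alt k n = begin
  defect (window (2 ℕ.+ k) f) n    ≡⟨ defect-window-suc (suc k) f n ⟩
  x + defect (window (suc k) f) (1 ℕ.+ n)  ≡⟨ cong (_+_ x) (defect-window-suc k f (suc n)) ⟩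
  x + (defect f (2 ℕ.+ n) + w)     ≡⟨ cong (λ y → x + (y + w)) (alt (suc n)) ⟩
  x + (- x + w)                    ≡⟨ cancel x w ⟩
  w                                ∎
  where
  x = defect f (suc n)
  w = defect (window k f) (2 ℕ.+ n)
  cancel : ∀ x w → x + (- x + w) ≡ w
  cancel = solve-∀

defect-window-even : ∀ f → Alternating (defect f) → ∀ k → 2 ∣ k →
  ∀ n → defect (window k f) n ≡ 0ℤ
defect-window-even f alt 0 _ n = refl
defect-window-even f alt 1 2∣1 n = contradiction (∣1⇒≡1 2∣1) λ ()
defect-window-even f alt (suc (suc k)) 2∣2+k n = trans
  (defect-window-+2 f alt k n)
  (defect-window-even f alt k (∣m+n∣m⇒∣n 2∣2+k ∣-refl) (2 ℕ.+ n))

defect-window-odd : ∀ f → Alternating (defect f) → ∀ k → 2 ∤ k →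
  ∀ n → defect (window k f) n ≡ defect f (suc n)
defect-window-odd f alt 0 2∤0 n = contradiction (2 ∣0) 2∤0
defect-window-odd f alt 1 _ n = trans
  (defect-window-suc 0 f n) (+-identityʳ (defect f (suc n)))
defect-window-odd f alt (suc (suc k)) 2∤2+k n = begin
  defect (window (2 ℕ.+ k) f) n   ≡⟨ defect-window-+2 f alt k n ⟩
  defect (window k f) (2 ℕ.+ n)   ≡⟨ defect-window-odd f alt k (λ 2∣k → 2∤2+k (∣m∣n⇒∣m+n-ℕ ∣-refl 2∣k)) (2 ℕ.+ n) ⟩
  -- Removing two terms moved the start by two, so the sign changes twice.
  defect f (3 ℕ.+ n)              ≡⟨ alt (2 ℕ.+ n) ⟩
  - defect f (2 ℕ.+ n)            ≡⟨ cong -_ (alt (1 ℕ.+ n)) ⟩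
  - - defect f (suc n)            ≡⟨ neg-involutive (defect f (suc n)) ⟩
  defect f (suc n)                ∎

alternating-∣ : ∀ c → Alternating c → ∀ n → c 0 Signed.∣ c n
alternating-∣ c alt zero    = Signed.∣-refl
alternating-∣ c alt (suc n) =
  subst (c 0 Signed.∣_) (sym (alt n)) (∣m⇒∣-m (alternating-∣ c alt n))

-- The hypothesis covers both parities: it holds when the defect vanishes and when it only changes
-- sign.
isGCD-defect : ∀ {S : ℕ → ℤ} → (∀ n → defect S 0 Signed.∣ defect S n) →
  IsGCD S (gcd (defect S 0) (gcd (S 1 - S 0) (S 2 - S 1)))
isGCD-defect {S} e∣ = record
  { nonneg   = +≤+ z≤n
  ; divides  = λ n → ∣⇒∣ᵤ (proj₁ (g∣ n))
  ; greatest = λ d d∣ → let d∣S n = ∣ᵤ⇒∣ {d} {S n} (d∣ n) in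
      gcd-greatest {e} {h} {d}
        (∣⇒∣ᵤ (∣m∣n⇒∣m+n (∣m∣n⇒∣m-n (d∣S 2) (∣n⇒∣m*n (+ 3) (d∣S 1))) (d∣S 0)))
        (gcd-greatest {S 1 - S 0} {S 2 - S 1} {d}
          (∣⇒∣ᵤ (∣m∣n⇒∣m-n (d∣S 1) (d∣S 0)))
          (∣⇒∣ᵤ (∣m∣n⇒∣m-n (d∣S 2) (d∣S 1))))
  }
  where
  e = defect S 0
  h = gcd (S 1 - S 0) (S 2 - S 1)
  g = gcd e h

  g∣e : g Signed.∣ e
  g∣e = ∣ᵤ⇒∣ (gcd[i,j]∣i e h)

  g∣h : g Signed.∣ h
  g∣h = ∣ᵤ⇒∣ (gcd[i,j]∣j e h)

  g∣S₁-S₀ : g Signed.∣ S 1 - S 0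
  g∣S₁-S₀ = Signed.∣-trans g∣h (∣ᵤ⇒∣ (gcd[i,j]∣i (S 1 - S 0) (S 2 - S 1)))

  g∣S₂-S₁ : g Signed.∣ S 2 - S 1
  g∣S₂-S₁ = Signed.∣-trans g∣h (∣ᵤ⇒∣ (gcd[i,j]∣j (S 1 - S 0) (S 2 - S 1)))

  -- The coefficients 1, -3, 1 add up to -1, a unit, so subtracting multiples of the differences
  -- from the defect isolates `S 0` up to sign.
  S₀-combination : ∀ x y z →
    ((z - y) - + 2 * (y - x)) - (z - + 3 * y + x) ≡ x
  S₀-combination = solve-∀

  S₁-combination : ∀ x y → (y - x) + x ≡ y
  S₁-combination = solve-∀

  recurrence : ∀ x y z → ((z - + 3 * y + x) + + 3 * y) - x ≡ z
  recurrence = solve-∀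

  g∣S₀ : g Signed.∣ S 0
  g∣S₀ = subst (g Signed.∣_) (S₀-combination (S 0) (S 1) (S 2))
    (∣m∣n⇒∣m-n (∣m∣n⇒∣m-n g∣S₂-S₁ (∣n⇒∣m*n (+ 2) g∣S₁-S₀)) g∣e)

  -- The recurrence has order two, so the induction carries two consecutive values.
  g∣ : ∀ n → g Signed.∣ S n × g Signed.∣ S (suc n)
  g∣ zero    = g∣S₀ ,
    subst (g Signed.∣_) (S₁-combination (S 0) (S 1)) (∣m∣n⇒∣m+n g∣S₁-S₀ g∣S₀)
  g∣ (suc n) with g∣ n
  ... | g∣Sₙ , g∣Sₙ₊₁ = g∣Sₙ₊₁ ,
    subst (g Signed.∣_) (recurrence (S n) (S (1 ℕ.+ n)) (S (2 ℕ.+ n)))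
      (∣m∣n⇒∣m-n
        (∣m∣n⇒∣m+n (Signed.∣-trans g∣e (e∣ n)) (∣n⇒∣m*n (+ 3) g∣Sₙ₊₁)) g∣Sₙ)

-- For Fibonacci-like G this is (-1)ⁿ μ G.
μ-shift : (ℕ → ℤ) → ℕ → ℤ
μ-shift G n = μ (λ i → G (i ℕ.+ n))

-- This is Cassini's identity in general form: the step from `(x, y)` to `(y, y + x)` negates the
-- quadratic form `y² - xy - x²`.
μ-shift-alternating : ∀ G → IsFibonacciLike G → Alternating (μ-shift G)
μ-shift-alternating G fib n rewrite fib n = identity (G n) (G (suc n))
  where
  identity : ∀ x y → (y + x) ^ 2 - y * (y + x) - y ^ 2 ≡ - (y ^ 2 - x * y - x ^ 2)
  identity = solve 2 (λ x y →
    (y :+ x) :^ 2 :- y :* (y :+ x) :- y :^ 2 := :- (y :^ 2 :- x :* y :- x :^ 2)) refl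

defect-squares : ∀ G → IsFibonacciLike G → ∀ n →
  defect (λ i → G i ^ 2) n ≡ - (+ 2 * μ-shift G n)
defect-squares G fib n rewrite fib n = identity (G n) (G (suc n))
  where
  identity : ∀ x y →
    (y + x) ^ 2 - + 3 * y ^ 2 + x ^ 2 ≡ - (+ 2 * (y ^ 2 - x * y - x ^ 2))
  identity = solve 2 (λ x y →
    (y :+ x) :^ 2 :- con (+ 3) :* y :^ 2 :+ x :^ 2
      := :- (con (+ 2) :* (y :^ 2 :- x :* y :- x :^ 2))) refl

defect-squares-alternating : ∀ G → IsFibonacciLike G →
  Alternating (defect (λ i → G i ^ 2))
defect-squares-alternating G fib n = begin
  defect a (suc n)              ≡⟨ defect-squares G fib (suc n) ⟩
  - (+ 2 * μ-shift G (suc n))   ≡⟨ cong (λ m → - (+ 2 * m)) (μ-shift-alternating G fib n) ⟩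
  - (+ 2 * - μ-shift G n)       ≡⟨ cong -_ (neg-distribʳ-* (+ 2) (μ-shift G n)) ⟨
  - - (+ 2 * μ-shift G n)       ≡⟨ cong -_ (defect-squares G fib n) ⟨
  - defect a n                  ∎
  where
  a : ℕ → ℤ
  a i = G i ^ 2

-- Index 1 matters because the window at 0 starts with the term at 1; its defect carries the
-- positive sign.
defect-squares-1 : ∀ G → IsFibonacciLike G →
  defect (λ i → G i ^ 2) 1 ≡ + 2 * μ G
defect-squares-1 G fib = begin
  defect (λ i → G i ^ 2) 1      ≡⟨ defect-squares-alternating G fib 0 ⟩
  - defect (λ i → G i ^ 2) 0    ≡⟨ cong -_ (defect-squares G fib 0) ⟩
  - - (+ 2 * μ G)               ≡⟨ neg-involutive (+ 2 * μ G) ⟩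
  + 2 * μ G                     ∎

theorem3p11 : (G : ℕ → ℤ) → IsFibonacciLike G → (k : ℕ) → 1 ℕ.≤ k →
    (2 ∣ k → 𝒢²[ G , k ]≡ gcd (G (k ℕ.+ 1) ^ 2 - G 1 ^ 2) (G (k ℕ.+ 2) ^ 2 - G 2 ^ 2))
    × (2 ∤ k → 𝒢²[ G , k ]≡ gcd (+ 2 * μ G) (gcd (G (k ℕ.+ 1) ^ 2 - G 1 ^ 2) (G (k ℕ.+ 2) ^ 2 - G 2 ^ 2)))
theorem3p11 G fib k _ = even , odd
  where
  a : ℕ → ℤ
  a i = G i ^ 2

  S : ℕ → ℤ
  S = window k a

  D : ℤ
  D = gcd (a (k ℕ.+ 1) - a 1) (a (k ℕ.+ 2) - a 2)

  alt : Alternating (defect a)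
  alt = defect-squares-alternating G fib

  isGCD : ∀ {e} → defect S 0 ≡ e → (∀ n → e Signed.∣ defect S n) → IsGCD S (gcd e D)
  isGCD refl e∣ = subst (λ d → IsGCD S (gcd (defect S 0) d))
    (cong₂ gcd (window-step k a 0) (window-step k a 1))
    (isGCD-defect e∣)

  even : 2 ∣ k → IsGCD S D
  -- The vanishing defect enters as `gcd 0ℤ D`. Since `D` is itself a gcd, `+ ∣ D ∣` computes to
  -- `D`.
  even 2∣k = subst (IsGCD S) (cong +_ (gcd-identityˡ ∣ D ∣))
    (isGCD (defect≡0 0) λ n → Signed.∣-reflexive (sym (defect≡0 n)))
    where
    defect≡0 : ∀ n → defect S n ≡ 0ℤ
    defect≡0 = defect-window-even a alt k 2∣k

  odd : 2 ∤ k → IsGCD S (gcd (+ 2 * μ G) D)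
  odd 2∤k = isGCD (trans (defect≡ 0) (defect-squares-1 G fib)) λ n →
    subst₂ Signed._∣_ (defect-squares-1 G fib) (sym (defect≡ n))
      -- The sequence is shifted by one so that its initial value is the defect at 1, which equals
      -- `+ 2 * μ G`.
      (alternating-∣ (λ m → defect a (suc m)) (λ m → alt (suc m)) n)
    where
    defect≡ : ∀ n → defect S n ≡ defect a (suc n)
    defect≡ = defect-window-odd a alt k 2∤k
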